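{- In the extra-special case, every antichain $\Gamma$ of $\Delta(1)$ satisfies $\#\Gamma\le 3$; equivalently, $\deg\mathcal N_{\Delta(1)}(t)\le 3$.
   Context: Let $\mathfrak g$ be a complex simple Lie algebra with root system $\Delta$ in a real Euclidean space with $W$-invariant inner product $(\,,\,)$, simple roots $\Pi$, highest root $\theta$, $\theta^\vee=2\theta/(\theta,\theta)$. Extra-special case: $\Delta(j)=\{\gamma\in\Delta:(\gamma,\theta^\vee)=j\}$; $\Pi(0)=\Pi\cap\Delta(0)$; $\Delta(1)$ is partially ordered by $\mu\preccurlyeq\gamma$ iff $\gamma-\mu$ is a nonnegative integer combination of $\Pi(0)$. $\mathcal N_{\Delta(1)}(t)=\sum_{\Gamma}t^{\#\Gamma}$, summed over all antichains $\Gamma$ of $\Delta(1)$. -}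

module Defs where

open import Data.Nat using (ℕ; zero; suc) renaming (_≤_ to _≤ℕ_)
open import Data.Integer using (ℤ; +_; _+_; _-_; _*_; _≤_; _<_; 0ℤ)
open import Data.Fin using (Fin; zero; suc)
open import Data.Bool using (Bool; true; false)
open import Data.Vec using (Vec; lookup; updateAt; replicate)
open import Data.List using (List)
open import Data.List.Relation.Unary.All using (All)
open import Data.List.Relation.Unary.AllPairs using (AllPairs)
open import Data.Product using (Σ-syntax; _×_; ∃-syntax)
open import Relation.Nullary using (¬_)
open import Relation.Binary.PropositionalEquality using (_≡_; _≢_)

sumℤ : ∀ {n} → (Fin n → ℤ) → ℤ
sumℤ {zero}  f = 0ℤ
sumℤ {suc n} f = f zero + sumℤ (λ i → f (suc i))

Matrix : ℕ → Set
Matrix n = Fin n → Fin n → ℤ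

-- Convention: A i j = ⟨α_i^∨ , α_j⟩ = 2(α_i,α_j)/(α_i,α_i).
-- Roots are represented by their coordinate vectors in the basis Π of simple roots.
-- Invariant form on simple roots: (α_i , α_j) = d i * A i j  (d a positive symmetrizer).
formMat : ∀ {n} → Matrix n → (Fin n → ℕ) → Matrix n
formMat A d i j = + d i * A i j

form : ∀ {n} → Matrix n → (Fin n → ℕ) → Vec ℤ n → Vec ℤ n → ℤ
form A d x y = sumℤ (λ i → sumℤ (λ j → lookup x i * formMat A d i j * lookup y j))

simpleRoot : ∀ {n} → Fin n → Vec ℤ n
simpleRoot {n} k = updateAt (replicate n 0ℤ) k (λ _ → + 1)

reflect : ∀ {n} → Matrix n → Fin n → Vec ℤ n → Vec ℤ n
reflect A i β = updateAt β i (λ b → b - sumℤ (λ j → A i j * lookup β j))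

data IsRoot {n : ℕ} (A : Matrix n) : Vec ℤ n → Set where
  simple  : ∀ k → IsRoot A (simpleRoot k)
  reflRoot : ∀ i β → IsRoot A β → IsRoot A (reflect A i β)

-- Cartan matrix (with symmetrizer d) of a complex simple Lie algebra:
-- indecomposable Cartan matrix of finite type, rank ≥ 1.
record IsSimpleCartan (n : ℕ) (A : Matrix n) (d : Fin n → ℕ) : Set where
  field
    rank-pos : 1 ≤ℕ n
    diag     : ∀ i → A i i ≡ + 2
    offdiag  : ∀ i j → i ≢ j → A i j ≤ 0ℤ
    d-pos    : ∀ i → 1 ≤ℕ d i
    symm     : ∀ i j → formMat A d i j ≡ formMat A d j i
    posdef   : ∀ (x : Vec ℤ n) → x ≢ replicate n 0ℤ → 0ℤ < form A d x x
    indecomp : ∀ (S : Fin n → Bool) (i j : Fin n) → S i ≡ true → S j ≡ false →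
               ∃[ k ] ∃[ l ] (S k ≡ true × S l ≡ false × A k l ≢ 0ℤ)

IsHighestRoot : ∀ {n} → Matrix n → Vec ℤ n → Set
IsHighestRoot {n} A θ = IsRoot A θ × (∀ β → IsRoot A β → ∀ i → lookup β i ≤ lookup θ i)

-- γ ∈ Δ(1) :  γ root and (γ , θ^∨) = 2(γ,θ)/(θ,θ) = 1
InΔ1 : ∀ {n} → Matrix n → (Fin n → ℕ) → Vec ℤ n → Vec ℤ n → Set
InΔ1 A d θ γ = IsRoot A γ × (+ 2 * form A d γ θ ≡ form A d θ θ)

InΠ0 : ∀ {n} → Matrix n → (Fin n → ℕ) → Vec ℤ n → Fin n → Set
InΠ0 A d θ i = form A d (simpleRoot i) θ ≡ 0ℤ

Prec : ∀ {n} → Matrix n → (Fin n → ℕ) → Vec ℤ n → Vec ℤ n → Vec ℤ n → Set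
Prec {n} A d θ μ γ =
  Σ[ c ∈ (Fin n → ℕ) ] ((∀ i → c i ≢ 0 → InΠ0 A d θ i) ×
                        (∀ i → lookup γ i ≡ lookup μ i + + c i))

-- Γ (listed without repetition) is an antichain of (Δ(1), ≼)
IsAntichainΔ1 : ∀ {n} → Matrix n → (Fin n → ℕ) → Vec ℤ n → List (Vec ℤ n) → Set
IsAntichainΔ1 A d θ Γ =
  All (InΔ1 A d θ) Γ ×
  AllPairs (λ x y → ¬ Prec A d θ x y × ¬ Prec A d θ y x) Γ

{-# OPTIONS --safe #-}
module Submission where

-- The difference of two distinct roots of Δ(1) with positive product is a root orthogonal to θ, hence
-- has coefficients of one sign, all supported on Π(0); so an antichain has pairwise products ≤ 0.
-- Four such roots satisfy |γ₁ + γ₂ + γ₃ + γ₄ − 2θ|² ≤ 0, as no root of Δ(1) is longer than θ.  Hence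
-- their sum is 2θ, they are orthogonal and as long as θ, and β₁ⱼ = θ − γ₁ − γⱼ behaves like
-- a root orthogonal to θ.  Now β₁₂ + β₁₃ = γ₄ − γ₁ and β₁₂ − β₁₃ = γ₃ − γ₂, and one of the two has
-- coefficients of one sign, which makes two of the γᵢ comparable.

open import Defs
open import Data.Nat using (ℕ; _≤_; zero; suc; z≤n; s≤s)
open import Data.Integer using (ℤ; +_; -[1+_]; 0ℤ; _+_; _-_; _*_; -_; _⊔_; ∣_∣; _≤?_; _≟_; +≤+; +<+)
  renaming (_≤_ to _≤ℤ_; _<_ to _<ℤ_)
open import Data.Integer.Properties as ℤ using (<⇒≤; <⇒≱; ≰⇒>; ≤-refl; ≤-trans; ≤-reflexive)
open import Data.Integer.Divisibility.Signed
  using (_∣_; divides; ∣m∣n⇒∣m+n; ∣m∣n⇒∣m-n; ∣m⇒∣m*n; ∣n⇒∣m*n;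
         ∣-refl; ∣-trans; *-monoʳ-∣; ∣m⇒∣-m)
open import Data.Integer.Tactic.RingSolver using (solve-∀)
open import Data.Fin using (Fin; zero; suc)
import Data.Fin.Properties as Fin
open import Data.Vec using (Vec; lookup; replicate; tabulate)
open import Data.Vec.Properties
  using (lookup∘tabulate; lookup-replicate; lookup∘updateAt; lookup∘updateAt′)
open import Data.List using (List; []; _∷_; foldr; length)
open import Data.List.Relation.Unary.All using (All; []; _∷_)
open import Data.List.Relation.Unary.AllPairs using ([]; _∷_)
open import Data.Product using (∃-syntax; _×_; _,_; proj₁; proj₂)
open import Data.Sum using (_⊎_; inj₁; inj₂; [_,_]′; swap)
open import Data.Empty using (⊥; ⊥-elim)
open import Function using (_∘_)
open import Relation.Nullary using (¬_; yes; no; contradiction)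
open import Relation.Binary.PropositionalEquality
  using (_≡_; _≢_; _≗_; refl; sym; trans; cong; cong₂; subst; module ≡-Reasoning)

-- Signs and divisibility of integers.

*-nonNeg : ∀ {a b} → 0ℤ ≤ℤ a → 0ℤ ≤ℤ b → 0ℤ ≤ℤ a * b
*-nonNeg {+ m} {+ n} _ _ = subst (0ℤ ≤ℤ_) (ℤ.pos-* m n) (+≤+ z≤n)

*-pos : ∀ {a b} → 0ℤ <ℤ a → 0ℤ <ℤ b → 0ℤ <ℤ a * b
*-pos {+ suc m} {+ suc n} _ _ = +<+ (s≤s z≤n)
*-pos {+ 0} (+<+ ()) _
*-pos {+ suc m} {+ 0} _ (+<+ ())

+-nonNeg : ∀ {a b} → 0ℤ ≤ℤ a → 0ℤ ≤ℤ b → 0ℤ ≤ℤ a + b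
+-nonNeg = ℤ.+-mono-≤

+-nonNeg-zeroˡ : ∀ {a b} → 0ℤ ≤ℤ a → 0ℤ ≤ℤ b → a + b ≡ 0ℤ → a ≡ 0ℤ
+-nonNeg-zeroˡ {+ zero}  {+ n} _ _ _ = refl
+-nonNeg-zeroˡ {+ suc m} {+ n} _ _ ()

+-nonNeg-zeroʳ : ∀ {a b} → 0ℤ ≤ℤ a → 0ℤ ≤ℤ b → a + b ≡ 0ℤ → b ≡ 0ℤ
+-nonNeg-zeroʳ {a} {b} p q e = +-nonNeg-zeroˡ q p (trans (ℤ.+-comm b a) e)

neg-nonNeg : ∀ {a} → a ≤ℤ 0ℤ → 0ℤ ≤ℤ - a
neg-nonNeg = ℤ.neg-mono-≤

nonNeg≢neg : ∀ {a b} → 0ℤ <ℤ b → 0ℤ ≤ℤ a → a ≢ - b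
nonNeg≢neg 0<b 0≤a refl = <⇒≱ 0<b (ℤ.neg-cancel-≤ 0≤a)

foldr-+-nonNeg : ∀ {xs} → All (0ℤ ≤ℤ_) xs → 0ℤ ≤ℤ foldr _+_ 0ℤ xs
foldr-+-nonNeg []       = ≤-refl
foldr-+-nonNeg (p ∷ ps) = +-nonNeg p (foldr-+-nonNeg ps)

foldr-+-zero : ∀ {xs} → All (0ℤ ≤ℤ_) xs → foldr _+_ 0ℤ xs ≡ 0ℤ → All (_≡ 0ℤ) xs
foldr-+-zero []       e = []
foldr-+-zero (p ∷ ps) e =
  +-nonNeg-zeroˡ p (foldr-+-nonNeg ps) e ∷ foldr-+-zero ps (+-nonNeg-zeroʳ p (foldr-+-nonNeg ps) e)

-- The quotient is a positive integer, so it is 1 or at least 2. Applied to the product of two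
-- roots, this dichotomy replaces a list of the possible angles.
pos-multiple : ∀ {D b} → 0ℤ <ℤ D → 0ℤ <ℤ b → D ∣ b → b ≡ D ⊎ D + D ≤ℤ b
pos-multiple _ 0<b (divides (+ 0) refl) = contradiction ≤-refl (<⇒≱ 0<b)
pos-multiple {D} _ _ (divides (+ 1) refl) = inj₁ (ℤ.*-identityˡ D)
pos-multiple {D} 0<D _ (divides (+ suc (suc n)) refl) = inj₂
  (ℤ.0≤i-j⇒j≤i (subst (0ℤ ≤ℤ_) (eq (+ n) D) (*-nonNeg {+ n} {D} (+≤+ z≤n) (<⇒≤ 0<D))))
  where
  eq : ∀ m D → m * D ≡ ((+ 2) + m) * D - (D + D)
  eq = solve-∀
pos-multiple {+ suc k} _ () (divides -[1+ n ] refl)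
pos-multiple {+ 0} (+<+ ()) _ _

≤-pos-multiple : ∀ {D b} → 0ℤ <ℤ D → 0ℤ <ℤ b → D ∣ b → D ≤ℤ b
≤-pos-multiple {D} 0<D 0<b D∣b with pos-multiple 0<D 0<b D∣b
... | inj₁ refl = ≤-refl
... | inj₂ 2D≤b = ≤-trans (subst (_≤ℤ D + D) (ℤ.+-identityʳ D) (ℤ.+-monoʳ-≤ D (<⇒≤ 0<D))) 2D≤b

-- Here `- x ⊔ 0ℤ` parses as `(- x) ⊔ 0ℤ`, the negative part of `x`.
pos-part : ∀ x → x ≡ (x ⊔ 0ℤ) - (- x ⊔ 0ℤ)
pos-part (+ 0)     = refl
pos-part (+ suc n) = sym (ℤ.+-identityʳ (+ suc n))
pos-part -[1+ n ]  = refl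

pos-part-disjoint : ∀ x → (x ⊔ 0ℤ) * (- x ⊔ 0ℤ) ≡ 0ℤ
pos-part-disjoint (+ 0)     = refl
pos-part-disjoint (+ suc n) = ℤ.*-zeroʳ (+ suc n)
pos-part-disjoint -[1+ n ]  = refl

-- Finite sums of integers.

sum-cong : ∀ {n} {f g : Fin n → ℤ} → f ≗ g → sumℤ f ≡ sumℤ g
sum-cong {zero}  e = refl
sum-cong {suc n} e = cong₂ _+_ (e zero) (sum-cong (e ∘ suc))

sum-zero : ∀ n → sumℤ {n} (λ _ → 0ℤ) ≡ 0ℤ
sum-zero zero    = refl
sum-zero (suc n) = trans (ℤ.+-identityˡ _) (sum-zero n)

sum-+ : ∀ {n} (f g : Fin n → ℤ) → sumℤ (λ i → f i + g i) ≡ sumℤ f + sumℤ g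
sum-+ {zero}  f g = refl
sum-+ {suc n} f g = trans (cong (_+_ (f zero + g zero)) (sum-+ (f ∘ suc) (g ∘ suc)))
  (eq (f zero) (g zero) (sumℤ (f ∘ suc)) (sumℤ (g ∘ suc)))
  where
  eq : ∀ a b c d → a + b + (c + d) ≡ a + c + (b + d)
  eq = solve-∀

*-distribˡ-sum : ∀ {n} c (f : Fin n → ℤ) → sumℤ (λ i → c * f i) ≡ c * sumℤ f
*-distribˡ-sum {zero}  c f = sym (ℤ.*-zeroʳ c)
*-distribˡ-sum {suc n} c f =
  trans (cong (_+_ (c * f zero)) (*-distribˡ-sum c (f ∘ suc))) (sym (ℤ.*-distribˡ-+ c _ _))

sum-comm : ∀ {m n} (f : Fin m → Fin n → ℤ) →
  sumℤ (λ i → sumℤ (f i)) ≡ sumℤ (λ j → sumℤ (λ i → f i j))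
sum-comm {zero}  {n} f = sym (sum-zero n)
sum-comm {suc m} f = trans (cong (_+_ (sumℤ (f zero))) (sum-comm (f ∘ suc)))
                           (sym (sum-+ (f zero) (λ j → sumℤ (λ i → f (suc i) j))))

sum-nonNeg : ∀ {n} {f : Fin n → ℤ} → (∀ i → 0ℤ ≤ℤ f i) → 0ℤ ≤ℤ sumℤ f
sum-nonNeg {zero}  p = ≤-refl
sum-nonNeg {suc n} p = +-nonNeg (p zero) (sum-nonNeg (p ∘ suc))

sum-nonPos : ∀ {n} {f : Fin n → ℤ} → (∀ i → f i ≤ℤ 0ℤ) → sumℤ f ≤ℤ 0ℤ
sum-nonPos {zero}  p = ≤-refl
sum-nonPos {suc n} p = ℤ.+-mono-≤ (p zero) (sum-nonPos (p ∘ suc))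

sum-nonNeg-zero : ∀ {n} {f : Fin n → ℤ} → (∀ i → 0ℤ ≤ℤ f i) → sumℤ f ≡ 0ℤ → ∀ i → f i ≡ 0ℤ
sum-nonNeg-zero p e zero    = +-nonNeg-zeroˡ (p zero) (sum-nonNeg (p ∘ suc)) e
sum-nonNeg-zero p e (suc i) =
  sum-nonNeg-zero (p ∘ suc) (+-nonNeg-zeroʳ (p zero) (sum-nonNeg (p ∘ suc)) e) i

sum-∣ : ∀ {n D} {f : Fin n → ℤ} → (∀ i → D ∣ f i) → D ∣ sumℤ f
sum-∣ {zero}  p = divides 0ℤ refl
sum-∣ {suc n} p = ∣m∣n⇒∣m+n (p zero) (sum-∣ (p ∘ suc))

sum-simpleRoot : ∀ {n} k (h : Fin n → ℤ) → sumℤ (λ i → lookup (simpleRoot k) i * h i) ≡ h k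
sum-simpleRoot {suc n} zero h = begin
  + 1 * h zero + sumℤ (λ i → lookup (replicate n 0ℤ) i * h (suc i))
    ≡⟨ cong₂ _+_ (ℤ.*-identityˡ (h zero)) (sum-cong λ i → cong (_* h (suc i)) (lookup-replicate i 0ℤ)) ⟩
  h zero + sumℤ {n} (λ _ → 0ℤ)
    ≡⟨ cong (_+_ (h zero)) (sum-zero n) ⟩
  h zero + 0ℤ
    ≡⟨ ℤ.+-identityʳ _ ⟩
  h zero ∎
  where open ≡-Reasoning
sum-simpleRoot {suc n} (suc k) h = trans (ℤ.+-identityˡ _) (sum-simpleRoot k (h ∘ suc))

-- Off-diagonal entries occur in equal pairs, so together they give twice a multiple of `D`. The
-- induction strips the first row and column, which share the sum `row`.
symmetric-sum-∣ : ∀ {n D} (S : Matrix n) → (∀ i j → S i j ≡ S j i) →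
  (∀ i j → D ∣ S i j) → (∀ i → + 2 * D ∣ S i i) → + 2 * D ∣ sumℤ (λ i → sumℤ (S i))
symmetric-sum-∣ {zero}  S s p q = divides 0ℤ refl
symmetric-sum-∣ {suc n} {D} S s p q = subst (+ 2 * D ∣_) (sym split)
  (∣m∣n⇒∣m+n (∣m∣n⇒∣m+n (q zero) (*-monoʳ-∣ (+ 2) (sum-∣ (p zero ∘ suc))))
             (symmetric-sum-∣ (λ i j → S (suc i) (suc j)) (λ i j → s (suc i) (suc j))
                              (λ i j → p (suc i) (suc j)) (q ∘ suc)))
  where
  row = sumℤ (λ j → S zero (suc j))
  rest = sumℤ (λ i → sumℤ (λ j → S (suc i) (suc j)))
  eq : ∀ a r t → a + r + (r + t) ≡ a + + 2 * r + t
  eq = solve-∀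
  split : sumℤ (λ i → sumℤ (S i)) ≡ S zero zero + + 2 * row + rest
  split = trans (cong (_+_ (S zero zero + row))
                  (trans (sum-+ (λ i → S (suc i) zero) (λ i → sumℤ (λ j → S (suc i) (suc j))))
                         (cong (_+ rest) (sum-cong λ i → s (suc i) zero))))
                (eq (S zero zero) row rest)

-- Coefficient functions and the invariant form.

infixl 6 _⊕_ _⊖_

_⊕_ _⊖_ : ∀ {n} → (Fin n → ℤ) → (Fin n → ℤ) → Fin n → ℤ
(f ⊕ g) i = f i + g i
(f ⊖ g) i = f i - g i

ConstantSign : ∀ {n} → (Fin n → ℤ) → Set
ConstantSign f = (∀ i → 0ℤ ≤ℤ f i) ⊎ (∀ i → f i ≤ℤ 0ℤ)

module _ {n : ℕ} (A : Matrix n) (d : Fin n → ℕ) (C : IsSimpleCartan n A d) where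
  open IsSimpleCartan C

  -- This is `form` on coefficient functions: `form A d x y` unfolds to the same sum as
  -- `B (lookup x) (lookup y)`. On functions, sums and differences compute pointwise.
  B : (Fin n → ℤ) → (Fin n → ℤ) → ℤ
  B f g = sumℤ (λ i → sumℤ (λ j → f i * formMat A d i j * g j))

  -- The inner product (α_i , g), as `B-simpleRoot` confirms.
  simplePairing : (Fin n → ℤ) → Fin n → ℤ
  simplePairing g i = sumℤ (λ j → formMat A d i j * g j)

  B-simplePairing : ∀ f g → B f g ≡ sumℤ (λ i → f i * simplePairing g i)
  B-simplePairing f g = sum-cong λ i →
    trans (sum-cong λ j → ℤ.*-assoc (f i) _ (g j)) (*-distribˡ-sum (f i) (λ j → formMat A d i j * g j))

  B-cong : ∀ {f f′ g g′} → f ≗ f′ → g ≗ g′ → B f g ≡ B f′ g′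
  B-cong p q = sum-cong λ i → sum-cong λ j → cong₂ _*_ (cong (_* formMat A d i j) (p i)) (q j)

  B-sym : ∀ f g → B f g ≡ B g f
  B-sym f g = trans (sum-comm (λ i j → f i * formMat A d i j * g j)) (sum-cong λ j → sum-cong λ i →
    trans (cong (λ m → f i * m * g j) (symm i j)) (eq (f i) (formMat A d j i) (g j)))
    where
    eq : ∀ a m b → a * m * b ≡ b * m * a
    eq = solve-∀

  -- The scalar `c` lets one computation, here and in `norm-linear`, serve sums (`+ 1`), differences
  -- (`- + 1`) and simple reflections (minus a coroot pairing).
  B-linear : ∀ c f g h → B (λ i → f i + c * g i) h ≡ B f h + c * B g h
  B-linear c f g h = begin
    B (λ i → f i + c * g i) h
      ≡⟨ B-simplePairing (λ i → f i + c * g i) h ⟩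
    sumℤ (λ i → (f i + c * g i) * simplePairing h i)
      ≡⟨ sum-cong (λ i → eq (f i) c (g i) (simplePairing h i)) ⟩
    sumℤ (λ i → f i * simplePairing h i + c * (g i * simplePairing h i))
      ≡⟨ sum-+ (λ i → f i * simplePairing h i) _ ⟩
    sumℤ (λ i → f i * simplePairing h i) + sumℤ (λ i → c * (g i * simplePairing h i))
      ≡⟨ cong₂ _+_ (sym (B-simplePairing f h))
           (trans (*-distribˡ-sum c (λ i → g i * simplePairing h i))
                  (cong (c *_) (sym (B-simplePairing g h)))) ⟩
    B f h + c * B g h ∎
    where
    open ≡-Reasoning
    eq : ∀ a c b t → (a + c * b) * t ≡ a * t + c * (b * t)
    eq = solve-∀

  norm-linear : ∀ c f g → let h = λ i → f i + c * g i in
    B h h ≡ B f f + + 2 * c * B f g + c * c * B g g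
  norm-linear c f g = begin
    B h h
      ≡⟨ B-linear c f g h ⟩
    B f h + c * B g h
      ≡⟨ cong₂ (λ x y → x + c * y) (trans (B-sym f h) (B-linear c f g f))
                                   (trans (B-sym g h) (B-linear c f g g)) ⟩
    B f f + c * B g f + c * (B f g + c * B g g)
      ≡⟨ cong (λ x → B f f + c * x + c * (B f g + c * B g g)) (B-sym g f) ⟩
    B f f + c * B f g + c * (B f g + c * B g g)
      ≡⟨ eq c (B f f) (B f g) (B g g) ⟩
    B f f + + 2 * c * B f g + c * c * B g g ∎
    where
    open ≡-Reasoning
    h = λ i → f i + c * g i
    eq : ∀ c x y z → x + c * y + c * (y + c * z) ≡ x + + 2 * c * y + c * c * z
    eq = solve-∀

  private
    ⊕-linear : ∀ a b → a + b ≡ a + + 1 * b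
    ⊕-linear = solve-∀
    ⊖-linear : ∀ a b → a - b ≡ a + (- + 1) * b
    ⊖-linear = solve-∀

  B-⊕ˡ : ∀ f g h → B (f ⊕ g) h ≡ B f h + B g h
  B-⊕ˡ f g h = trans (B-cong (λ i → ⊕-linear (f i) (g i)) (λ _ → refl))
                     (trans (B-linear (+ 1) f g h) (sym (⊕-linear (B f h) (B g h))))

  B-⊖ˡ : ∀ f g h → B (f ⊖ g) h ≡ B f h - B g h
  B-⊖ˡ f g h = trans (B-cong (λ i → ⊖-linear (f i) (g i)) (λ _ → refl))
                     (trans (B-linear (- + 1) f g h) (sym (⊖-linear (B f h) (B g h))))

  B-⊕ʳ : ∀ f g h → B f (g ⊕ h) ≡ B f g + B f h
  B-⊕ʳ f g h = trans (B-sym f (g ⊕ h)) (trans (B-⊕ˡ g h f) (cong₂ _+_ (B-sym g f) (B-sym h f)))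

  norm-⊕ : ∀ f g → B (f ⊕ g) (f ⊕ g) ≡ B f f + B g g + + 2 * B f g
  norm-⊕ f g = trans (B-cong e e) (trans (norm-linear (+ 1) f g) (eq (B f f) (B f g) (B g g)))
    where
    e : ∀ i → _
    e i = ⊕-linear (f i) (g i)
    eq : ∀ x y z → x + + 2 * + 1 * y + + 1 * + 1 * z ≡ x + z + + 2 * y
    eq = solve-∀

  norm-⊖ : ∀ f g → B (f ⊖ g) (f ⊖ g) ≡ B f f + B g g - + 2 * B f g
  norm-⊖ f g = trans (B-cong e e) (trans (norm-linear (- + 1) f g) (eq (B f f) (B f g) (B g g)))
    where
    e : ∀ i → _
    e i = ⊖-linear (f i) (g i)
    eq : ∀ x y z → x + + 2 * (- + 1) * y + (- + 1) * (- + 1) * z ≡ x + z - + 2 * y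
    eq = solve-∀

  -- `posdef` speaks of vectors; `tabulate f` carries it over to functions, with pointwise equality
  -- in place of function extensionality.
  norm-pos : ∀ f → ¬ (∀ i → f i ≡ 0ℤ) → 0ℤ <ℤ B f f
  norm-pos f f≢0 = subst (0ℤ <ℤ_) (B-cong (lookup∘tabulate f) (lookup∘tabulate f))
    (posdef (tabulate f) λ e → f≢0 λ i →
      trans (sym (lookup∘tabulate f i)) (trans (cong (λ v → lookup v i) e) (lookup-replicate i 0ℤ)))

  norm-≤0 : ∀ f → B f f ≤ℤ 0ℤ → ∀ i → f i ≡ 0ℤ
  norm-≤0 f p with Fin.all? (λ i → f i ≟ 0ℤ)
  ... | yes z = z
  ... | no ¬z = contradiction p (<⇒≱ (norm-pos f ¬z))

  norm-nonNeg : ∀ f → 0ℤ ≤ℤ B f f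
  norm-nonNeg f with Fin.all? (λ i → f i ≟ 0ℤ)
  ... | no ¬z = <⇒≤ (norm-pos f ¬z)
  ... | yes z = subst (0ℤ ≤ℤ_) (sym (B-simplePairing f f))
    (sum-nonNeg λ i → ≤-reflexive (sym (cong (_* simplePairing f i) (z i))))

  -- Simple roots, simple reflections and roots.

  B-simpleRoot : ∀ k h → B (lookup (simpleRoot k)) h ≡ simplePairing h k
  B-simpleRoot k h = trans (B-simplePairing (lookup (simpleRoot k)) h) (sum-simpleRoot k (simplePairing h))

  -- The integer ⟨α_i^∨ , f⟩, which `reflect A i` subtracts from the i-th coordinate.
  corootPairing : (Fin n → ℤ) → Fin n → ℤ
  corootPairing f i = sumℤ (λ j → A i j * f j)

  simplePairing-corootPairing : ∀ f i → simplePairing f i ≡ + d i * corootPairing f i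
  simplePairing-corootPairing f i =
    trans (sum-cong λ j → ℤ.*-assoc (+ d i) (A i j) (f j))
          (*-distribˡ-sum (+ d i) (λ j → A i j * f j))

  norm-simpleRoot : ∀ k → B (lookup (simpleRoot k)) (lookup (simpleRoot k)) ≡ + 2 * + d k
  norm-simpleRoot k = begin
    B e e                               ≡⟨ B-simpleRoot k e ⟩
    simplePairing e k                   ≡⟨ sum-cong (λ j → ℤ.*-comm (formMat A d k j) (e j)) ⟩
    sumℤ (λ j → e j * formMat A d k j)  ≡⟨ sum-simpleRoot k (formMat A d k) ⟩
    + d k * A k k                       ≡⟨ cong (+ d k *_) (diag k) ⟩
    + d k * + 2                         ≡⟨ ℤ.*-comm (+ d k) (+ 2) ⟩
    + 2 * + d k ∎
    where
    open ≡-Reasoning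
    e = lookup (simpleRoot k)

  -- Turns the update of a single coordinate into the subtraction of a multiple of α_i, a form to
  -- which bilinearity applies.
  reflect-lookup : ∀ i β j →
    lookup (reflect A i β) j ≡ lookup β j + (- corootPairing (lookup β) i) * lookup (simpleRoot i) j
  reflect-lookup i β j with i Fin.≟ j
  ... | yes refl = trans (lookup∘updateAt i β)
      (trans (eq (lookup β i) (corootPairing (lookup β) i))
      (cong (λ z → lookup β i + (- corootPairing (lookup β) i) * z)
                            (sym (lookup∘updateAt i (replicate n 0ℤ)))))
    where
    eq : ∀ a b → a - b ≡ a + (- b) * + 1
    eq = solve-∀
  ... | no i≢j = trans (lookup∘updateAt′ j i (i≢j ∘ sym) β)
      (trans (eq (lookup β j) (corootPairing (lookup β) i))
      (cong (λ z → lookup β j + (- corootPairing (lookup β) i) * z)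
        (sym (trans (lookup∘updateAt′ j i (i≢j ∘ sym) (replicate n 0ℤ)) (lookup-replicate j 0ℤ)))))
    where
    eq : ∀ a b → a ≡ a + (- b) * 0ℤ
    eq = solve-∀

  -- With (β , α_i) = d_i c and (α_i , α_i) = 2 d_i, the two correction terms are -2 d_i c² and 2
  -- d_i c².
  norm-reflect : ∀ i β → B (lookup (reflect A i β)) (lookup (reflect A i β)) ≡ B (lookup β) (lookup β)
  norm-reflect i β = begin
    B (lookup (reflect A i β)) (lookup (reflect A i β))
      ≡⟨ B-cong (reflect-lookup i β) (reflect-lookup i β) ⟩
    B (λ j → b j + (- c) * e j) (λ j → b j + (- c) * e j)
      ≡⟨ norm-linear (- c) b e ⟩
    B b b + + 2 * (- c) * B b e + (- c) * (- c) * B e e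
      ≡⟨ cong₂ (λ x y → B b b + + 2 * (- c) * x + (- c) * (- c) * y)
           (trans (B-sym b e) (trans (B-simpleRoot i b) (simplePairing-corootPairing b i)))
           (norm-simpleRoot i) ⟩
    B b b + + 2 * (- c) * (+ d i * c) + (- c) * (- c) * (+ 2 * + d i)
      ≡⟨ eq (B b b) c (+ d i) ⟩
    B b b ∎
    where
    open ≡-Reasoning
    b = lookup β
    e = lookup (simpleRoot i)
    c = corootPairing b i
    eq : ∀ x c k → x + + 2 * (- c) * (k * c) + (- c) * (- c) * (+ 2 * k) ≡ x
    eq = solve-∀

  -- The last field says that the coroot f / D is integral in the basis of simple coroots α_i / d i.
  record RootLike (D : ℤ) (f : Fin n → ℤ) : Set where
    field
      scale-pos : 0ℤ <ℤ D
      norm      : B f f ≡ + 2 * D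
      integral  : ∀ i → D ∣ + d i * f i
  open RootLike

  -- Induction on the reflections producing the root. The number `D` is half the squared length: it
  -- is `d k` for α_k, and reflections preserve it.
  root⇒rootLike : ∀ {β} → IsRoot A β → ∃[ D ] RootLike D (lookup β)
  root⇒rootLike (simple k) = + d k , record
    { scale-pos = 0<d (d-pos k)
    ; norm      = norm-simpleRoot k
    ; integral  = int
    }
    where
    0<d : ∀ {m} → 1 ≤ m → 0ℤ <ℤ + m
    0<d p = +<+ p
    int : ∀ i → + d k ∣ + d i * lookup (simpleRoot k) i
    int i with i Fin.≟ k
    ... | yes refl = ∣m⇒∣m*n _ ∣-refl
    ... | no i≢k = divides 0ℤ
      (trans (cong (+ d i *_) (trans (lookup∘updateAt′ i k i≢k (replicate n 0ℤ)) (lookup-replicate i 0ℤ)))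
             (ℤ.*-zeroʳ (+ d i)))
  root⇒rootLike (reflRoot i β r) with root⇒rootLike r
  ... | D , R = D , record
    { scale-pos = scale-pos R
    ; norm      = trans (norm-reflect i β) (norm R)
    ; integral  = λ j → subst (D ∣_) (sym (eq₁ j))
        (∣m∣n⇒∣m-n (integral R j) (int j))
    }
    where
    b = lookup β
    c = corootPairing b i
    e = lookup (simpleRoot i)
    dist : ∀ k x c y → k * (x + (- c) * y) ≡ k * x - k * c * y
    dist = solve-∀
    eq₁ : ∀ j → + d j * lookup (reflect A i β) j ≡ + d j * b j - + d j * c * e j
    eq₁ j = trans (cong (+ d j *_) (reflect-lookup i β j)) (dist (+ d j) (b j) c (e j))
    assoc-comm : ∀ a k x → k * a * x ≡ a * (k * x)
    assoc-comm = solve-∀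
    -- By symmetry of the form, (α_i , β) is the sum of the `A k i * (d k * b k)`, and integrality
    -- of β applies to each bracket.
    D∣dc : D ∣ + d i * c
    D∣dc = subst (D ∣_) (simplePairing-corootPairing b i) (sum-∣ λ k → subst (D ∣_)
      (sym (trans (cong (_* b k) (symm i k)) (assoc-comm (A k i) (+ d k) (b k))))
      (∣n⇒∣m*n (A k i) (integral R k)))
    int : ∀ j → D ∣ + d j * c * e j
    int j with j Fin.≟ i
    ... | yes refl = ∣m⇒∣m*n (e i) D∣dc
    ... | no j≢i = divides 0ℤ
      (trans (cong (+ d j * c *_) (trans (lookup∘updateAt′ j i j≢i (replicate n 0ℤ)) (lookup-replicate j 0ℤ)))
             (ℤ.*-zeroʳ (+ d j * c)))

  -- Divisibility of products and constancy of sign.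

  private
    regroup : ∀ a k m b → k * a * (m * b) ≡ a * (k * m) * b
    regroup = solve-∀

  -- Each term is (d_i f_i) A_ij g_j. For root-like `f` the quotient is the integer ⟨f^∨ , g⟩.
  B-∣ : ∀ {D f} → (∀ i → D ∣ + d i * f i) → ∀ g → D ∣ B f g
  B-∣ {D} {f} p g = sum-∣ λ i → sum-∣ λ j →
    subst (D ∣_) (regroup (f i) (+ d i) (A i j) (g j)) (∣m⇒∣m*n (A i j * g j) (p i))

  -- Diagonal terms get the extra factor 2 from `A i i`, the others from occurring in symmetric
  -- pairs.
  norm-even : ∀ {D f} → (∀ i → D ∣ + d i * f i) → + 2 * D ∣ B f f
  norm-even {D} {f} p = symmetric-sum-∣ (λ i j → f i * formMat A d i j * f j)
    (λ i j → trans (cong (λ m → f i * m * f j) (symm i j)) (sw (f i) _ (f j)))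
    (λ i j → subst (D ∣_) (regroup (f i) (+ d i) (A i j) (f j)) (∣m⇒∣m*n (A i j * f j) (p i)))
    λ i → subst (+ 2 * D ∣_)
      (trans (diag-eq (f i) (+ d i)) (cong (λ m → f i * (+ d i * m) * f i) (sym (diag i))))
      (∣m⇒∣m*n (f i) (*-monoʳ-∣ (+ 2) (p i)))
    where
    sw : ∀ a m b → a * m * b ≡ b * m * a
    sw = solve-∀
    diag-eq : ∀ a k → + 2 * (k * a) * a ≡ a * (k * + 2) * a
    diag-eq = solve-∀

  -- The norm is a positive multiple of 2D. So no nonzero vector with this integrality is shorter
  -- than a root-like vector of scale `D`.
  norm-lower : ∀ {D f} → 0ℤ <ℤ D → (∀ i → D ∣ + d i * f i) → ¬ (∀ i → f i ≡ 0ℤ) → + 2 * D ≤ℤ B f f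
  norm-lower 0<D p f≢0 = ≤-pos-multiple (*-pos {+ 2} (+<+ (s≤s z≤n)) 0<D) (norm-pos _ f≢0) (norm-even p)

  -- Disjoint supports kill the diagonal terms, and the off-diagonal Cartan entries are at most 0.
  B-disjoint : ∀ p q → (∀ i → 0ℤ ≤ℤ p i) → (∀ i → 0ℤ ≤ℤ q i) → (∀ i → p i * q i ≡ 0ℤ) → B p q ≤ℤ 0ℤ
  B-disjoint p q 0≤p 0≤q pq≡0 = sum-nonPos λ i → sum-nonPos λ j → term i j
    where
    eq₁ : ∀ a m b → a * m * b ≡ m * (a * b)
    eq₁ = solve-∀
    eq₂ : ∀ a k m b → k * (a * b) * (- m) ≡ - (a * (k * m) * b)
    eq₂ = solve-∀
    term : ∀ i j → p i * formMat A d i j * q j ≤ℤ 0ℤ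
    term i j with i Fin.≟ j
    ... | yes refl = ≤-reflexive (trans (eq₁ (p i) _ (q i))
      (trans (cong (formMat A d i i *_) (pq≡0 i)) (ℤ.*-zeroʳ (formMat A d i i))))
    ... | no i≢j = ℤ.neg-cancel-≤ (subst (0ℤ ≤ℤ_) (eq₂ (p i) (+ d i) (A i j) (q j))
      (*-nonNeg (*-nonNeg {+ d i} (+≤+ z≤n) (*-nonNeg (0≤p i) (0≤q j))) (neg-nonNeg (offdiag i j i≢j))))

  -- If f = p − q had p, q ≠ 0, then |f|² ≥ |p|² + |q|² ≥ 4D, whereas |f|² = 2D.
  rootLike⇒constantSign : ∀ {D f} → RootLike D f → ConstantSign f
  rootLike⇒constantSign {D} {f} R with Fin.all? (λ i → 0ℤ ≤? f i) | Fin.all? (λ i → f i ≤? 0ℤ)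
  ... | yes f≥0 | _       = inj₁ f≥0
  ... | no _    | yes f≤0 = inj₂ f≤0
  -- The nonnegative numbers |p|² - 2D, |q|² - 2D and -2(p , q) add up to |f|² - 4D = -2D, which is
  -- negative.
  ... | no f≱0  | no f≰0  = ⊥-elim (nonNeg≢neg (*-pos {+ 2} (+<+ (s≤s z≤n)) (scale-pos R))
      (+-nonNeg (+-nonNeg (ℤ.i≤j⇒0≤j-i (norm-lower (scale-pos R) int-p p≢0))
                          (ℤ.i≤j⇒0≤j-i (norm-lower (scale-pos R) int-q q≢0)))
                (*-nonNeg {+ 2} (+≤+ z≤n) (neg-nonNeg (B-disjoint p q 0≤p 0≤q (pos-part-disjoint ∘ f)))))
      (trans (eq (B p p) (B q q) (B p q) D) (trans (cong (_- + 2 * (+ 2 * D)) total) (eq′ D))))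
    where
    p q : Fin n → ℤ
    p i = f i ⊔ 0ℤ
    q i = - f i ⊔ 0ℤ
    0≤p : ∀ i → 0ℤ ≤ℤ p i
    0≤p i = ℤ.i≤j⊔i (f i) 0ℤ
    0≤q : ∀ i → 0ℤ ≤ℤ q i
    0≤q i = ℤ.i≤j⊔i (- f i) 0ℤ
    p≢0 : ¬ (∀ i → p i ≡ 0ℤ)
    p≢0 z = f≰0 λ i → subst (f i ≤ℤ_) (z i) (ℤ.i≤i⊔j (f i) 0ℤ)
    q≢0 : ¬ (∀ i → q i ≡ 0ℤ)
    q≢0 z = f≱0 λ i → ℤ.neg-cancel-≤ (subst (- f i ≤ℤ_) (z i) (ℤ.i≤i⊔j (- f i) 0ℤ))
    -- Integrality passes to `p` and `q`, since each of their coefficients is 0 or a coefficient of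
    -- `f` up to sign.
    ⊔0-∣ : ∀ k x → D ∣ k * x → D ∣ k * (x ⊔ 0ℤ)
    ⊔0-∣ k x D∣kx with ℤ.⊔-sel x 0ℤ
    ... | inj₁ e = subst (λ y → D ∣ k * y) (sym e) D∣kx
    ... | inj₂ e = subst (λ y → D ∣ k * y) (sym e) (divides 0ℤ (ℤ.*-zeroʳ k))
    int-p : ∀ i → D ∣ + d i * p i
    int-p i = ⊔0-∣ (+ d i) (f i) (integral R i)
    int-q : ∀ i → D ∣ + d i * q i
    int-q i = ⊔0-∣ (+ d i) (- f i) (subst (D ∣_) (ℤ.neg-distribʳ-* (+ d i) (f i)) (∣m⇒∣-m (integral R i)))
    total : B p p + B q q - + 2 * B p q ≡ + 2 * D
    total = trans (sym (norm-⊖ p q)) (trans (sym (B-cong (pos-part ∘ f) (pos-part ∘ f))) (norm R))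
    eq : ∀ x y z D → x - + 2 * D + (y - + 2 * D) + + 2 * (- z) ≡ x + y - + 2 * z - + 2 * (+ 2 * D)
    eq = solve-∀
    eq′ : ∀ D → + 2 * D - + 2 * (+ 2 * D) ≡ - (+ 2 * D)
    eq′ = solve-∀

  -- The hypothesis says ⟨f^∨ , g⟩ = 1, so f - g is minus the reflection of g in f and has the norm
  -- of g. As `E` divides (f , g) = D, integrality of f with respect to `D` gives integrality with
  -- respect to `E`.
  ⊖-rootLike : ∀ {D E f g} → RootLike D f → RootLike E g → B f g ≡ D → RootLike E (f ⊖ g)
  ⊖-rootLike {D} {E} {f} {g} R S b≡D = record
    { scale-pos = scale-pos S
    ; norm      = trans (norm-⊖ f g) (trans
        (cong₂ (λ x y → x - + 2 * y) (cong₂ _+_ (norm R) (norm S)) b≡D) (eq D E))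
    ; integral  = λ i → subst (E ∣_) (sym (dist (+ d i) (f i) (g i)))
        (∣m∣n⇒∣m-n (∣-trans E∣D (integral R i)) (integral S i))
    }
    where
    eq : ∀ D E → + 2 * D + + 2 * E - + 2 * D ≡ + 2 * E
    eq = solve-∀
    dist : ∀ k x y → k * (x - y) ≡ k * x - k * y
    dist = solve-∀
    E∣D : E ∣ D
    E∣D = subst (E ∣_) (trans (B-sym g f) b≡D) (B-∣ (integral S) f)

  -- The highest root and the order on Δ(1).

  module _ {θ : Vec ℤ n} (highest : IsHighestRoot A θ) where
    private
      t : Fin n → ℤ
      t = lookup θ

    -- Reflecting θ in α_i gives a root whose i-th coordinate is smaller by ⟨α_i^∨ , θ⟩; as θ is
    -- highest, this integer is not negative.
    dominant : ∀ i → 0ℤ ≤ℤ simplePairing t i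
    dominant i = subst (0ℤ ≤ℤ_) (sym (simplePairing-corootPairing t i)) (*-nonNeg {+ d i} (+≤+ z≤n) 0≤c)
      where
      eq : ∀ a c → a - (a - c) ≡ c
      eq = solve-∀
      0≤c : 0ℤ ≤ℤ corootPairing t i
      0≤c = subst (0ℤ ≤ℤ_) (trans (cong (λ z → t i - z) (lookup∘updateAt i θ))
        (eq (t i) (corootPairing t i)))
        (ℤ.i≤j⇒0≤j-i (proj₂ highest (reflect A i θ) (reflRoot i θ (proj₁ highest)) i))

    Comparable : Vec ℤ n → Vec ℤ n → Set
    Comparable μ γ = Prec A d θ μ γ ⊎ Prec A d θ γ μ

    -- The sum of the h_i (α_i , θ) is (γ - μ , θ) = 0 and has nonnegative terms, so each term
    -- vanishes. Hence h_i ≠ 0 forces α_i into Π(0).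
    nonNeg⇒prec : ∀ {μ γ} → (∀ i → 0ℤ ≤ℤ lookup γ i - lookup μ i) →
      B (lookup γ) t ≡ B (lookup μ) t → Prec A d θ μ γ
    nonNeg⇒prec {μ} {γ} 0≤h orth = (λ i → ∣ h i ∣) , support , λ i →
      sym (trans (cong (_+_ (lookup μ i)) (ℤ.0≤i⇒+∣i∣≡i (0≤h i))) (eq (lookup μ i) (lookup γ i)))
      where
      h = lookup γ ⊖ lookup μ
      eq : ∀ m g → m + (g - m) ≡ g
      eq = solve-∀
      terms : ∀ i → h i * simplePairing t i ≡ 0ℤ
      terms = sum-nonNeg-zero (λ i → *-nonNeg (0≤h i) (dominant i))
        (trans (sym (B-simplePairing h t)) (trans (B-⊖ˡ (lookup γ) (lookup μ) t) (ℤ.i≡j⇒i-j≡0 orth)))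
      support : ∀ i → ∣ h i ∣ ≢ 0 → InΠ0 A d θ i
      support i hi≢0 with ℤ.i*j≡0⇒i≡0∨j≡0 (h i) (terms i)
      ... | inj₁ z = contradiction (cong ∣_∣ z) hi≢0
      ... | inj₂ z = trans (B-simpleRoot i t) z

    -- The function `f` is tied to γ - μ only pointwise, so that the difference may arrive in
    -- another shape, such as a sum of two root-like vectors.
    constantSign⇒comparable : ∀ {μ γ f} → ConstantSign f → (∀ i → f i ≡ lookup γ i - lookup μ i) →
      B (lookup γ) t ≡ B (lookup μ) t → Comparable μ γ
    constantSign⇒comparable {μ} {γ} (inj₁ 0≤f) e orth =
      inj₁ (nonNeg⇒prec {μ} {γ} (λ i → subst (0ℤ ≤ℤ_) (e i) (0≤f i)) orth)
    constantSign⇒comparable {μ} {γ} (inj₂ f≤0) e orth = inj₂ (nonNeg⇒prec {γ} {μ}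
      (λ i → subst (0ℤ ≤ℤ_) (trans (cong -_ (e i)) (eq (lookup γ i) (lookup μ i)))
        (neg-nonNeg (f≤0 i))) (sym orth))
      where
      eq : ∀ a b → - (a - b) ≡ b - a
      eq = solve-∀

    -- Products of elements of Δ(1).

    module _ {D : ℤ} (Rθ : RootLike D t) where

      -- As |θ|² = 2D, the equation (γ , θ) = D says (γ , θ^∨) = 1. The scale is half of |γ|².
      record Δ1Root (γ : Vec ℤ n) : Set where
        field
          {scale}  : ℤ
          rootLike : RootLike scale (lookup γ)
          pairing  : B (lookup γ) t ≡ D
      open Δ1Root

      InΔ1⇒Δ1Root : ∀ {γ} → InΔ1 A d θ γ → Δ1Root γ
      InΔ1⇒Δ1Root {γ} (r , e) = record
        { rootLike = proj₂ (root⇒rootLike r)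
        ; pairing  = ℤ.*-cancelˡ-≡ (+ 2) (B (lookup γ) t) D (trans e (norm Rθ))
        }

      -- The positive number D = (γ , θ) is a multiple of the scale of γ; hence γ is not longer than
      -- θ.
      scale≤ : ∀ {γ} (G : Δ1Root γ) → scale G ≤ℤ D
      scale≤ G = ≤-pos-multiple (scale-pos (rootLike G)) (scale-pos Rθ)
        (subst (scale G ∣_) (pairing G) (B-∣ (integral (rootLike G)) t))

      constantSign⇒comparable-Δ1 : ∀ {μ γ f} → Δ1Root μ → Δ1Root γ → ConstantSign f →
        (∀ i → f i ≡ lookup γ i - lookup μ i) → Comparable μ γ
      constantSign⇒comparable-Δ1 {μ} {γ} M G s e =
        constantSign⇒comparable {μ} {γ} s e (trans (pairing G) (sym (pairing M)))

      -- A positive product of distinct roots equals one of the two scales, since otherwise it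
      -- is at least their sum and |μ − γ|² ≤ 0; hence the difference is again a root.
      positive⇒comparable : ∀ {μ γ} → Δ1Root μ → Δ1Root γ → 0ℤ <ℤ B (lookup μ) (lookup γ) →
        Comparable μ γ
      positive⇒comparable {μ} {γ} M G 0<b
        with pos-multiple (scale-pos (rootLike M)) 0<b (B-∣ (integral (rootLike M)) (lookup γ))
           | pos-multiple (scale-pos (rootLike G)) 0<b
               (subst (scale G ∣_) (B-sym (lookup γ) (lookup μ)) (B-∣ (integral (rootLike G)) (lookup μ)))
      ... | inj₁ b≡M | _ = swap (constantSign⇒comparable-Δ1 G M
              (rootLike⇒constantSign (⊖-rootLike (rootLike M) (rootLike G) b≡M)) λ _ → refl)
      ... | inj₂ _ | inj₁ b≡G = constantSign⇒comparable-Δ1 M G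
              (rootLike⇒constantSign (⊖-rootLike (rootLike G) (rootLike M)
                (trans (B-sym (lookup γ) (lookup μ)) b≡G))) λ _ → refl
      ... | inj₂ 2M≤b | inj₂ 2G≤b = constantSign⇒comparable-Δ1 M G
              (inj₁ λ i → ≤-reflexive (sym (norm-≤0 (lookup γ ⊖ lookup μ) norm≤0 i))) λ _ → refl
        where
        b = B (lookup μ) (lookup γ)
        eq : ∀ m g b → b - (m + m) + (b - (g + g)) ≡ - (+ 2 * g + + 2 * m - + 2 * b)
        eq = solve-∀
        norm≤0 : B (lookup γ ⊖ lookup μ) (lookup γ ⊖ lookup μ) ≤ℤ 0ℤ
        norm≤0 = ℤ.neg-cancel-≤ (subst (0ℤ ≤ℤ_)
          (trans (eq (scale M) (scale G) b) (cong -_ (sym (trans (norm-⊖ (lookup γ) (lookup μ))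
            (cong₂ (λ x y → x - + 2 * y) (cong₂ _+_ (norm (rootLike G)) (norm (rootLike M)))
                   (B-sym (lookup γ) (lookup μ)))))))
          (+-nonNeg (ℤ.i≤j⇒0≤j-i 2M≤b) (ℤ.i≤j⇒0≤j-i 2G≤b)))

      Incomparable : Vec ℤ n → Vec ℤ n → Set
      Incomparable μ γ = ¬ Prec A d θ μ γ × ¬ Prec A d θ γ μ

      incomparable⇒≤0 : ∀ {μ γ} → Δ1Root μ → Δ1Root γ → Incomparable μ γ →
        B (lookup μ) (lookup γ) ≤ℤ 0ℤ
      incomparable⇒≤0 {μ} {γ} M G (¬p , ¬q) with B (lookup μ) (lookup γ) ≤? 0ℤ
      ... | yes b≤0 = b≤0
      ... | no b≰0  = ⊥-elim ([ ¬p , ¬q ]′ (positive⇒comparable M G (≰⇒> b≰0)))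

      -- θ - μ - γ is the image of θ under the reflections in γ and then μ: both are as long as θ,
      -- so their coroots take the value 1 on θ, and they are orthogonal. Norm and integrality are
      -- checked directly.
      θ⊖⊕-rootLike : ∀ {μ γ} (M : Δ1Root μ) (G : Δ1Root γ) → D ≡ scale M → D ≡ scale G →
        B (lookup μ) (lookup γ) ≡ 0ℤ → RootLike D (t ⊖ (lookup μ ⊕ lookup γ))
      θ⊖⊕-rootLike {μ} {γ} M G refl D≡G b≡0 = record
        { scale-pos = scale-pos Rθ
        ; norm      = begin
            B (t ⊖ (m ⊕ g)) (t ⊖ (m ⊕ g))
              ≡⟨ norm-⊖ t (m ⊕ g) ⟩
            B t t + B (m ⊕ g) (m ⊕ g) - + 2 * B t (m ⊕ g)
              ≡⟨ cong₂ (λ x y → B t t + x - + 2 * y) (norm-⊕ m g)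
                   (trans (B-sym t (m ⊕ g)) (B-⊕ˡ m g t)) ⟩
            B t t + (B m m + B g g + + 2 * B m g) - + 2 * (B m t + B g t)
              ≡⟨ cong₂ (λ x y → x - + 2 * y)
                   (cong₂ _+_ (norm Rθ) (cong₂ _+_ (cong₂ _+_ (norm (rootLike M))
                     (trans (norm (rootLike G)) (cong (+ 2 *_) (sym D≡G)))) (cong (+ 2 *_) b≡0)))
                   (cong₂ _+_ (pairing M) (pairing G)) ⟩
            + 2 * D + (+ 2 * D + + 2 * D + + 2 * 0ℤ) - + 2 * (D + D)
              ≡⟨ eq D ⟩
            + 2 * D ∎
        ; integral  = λ i → subst (D ∣_) (dist (+ d i) (t i) (m i) (g i))
            (∣m∣n⇒∣m-n (integral Rθ i) (∣m∣n⇒∣m+n (integral (rootLike M) i)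
              (subst (_∣ + d i * g i) (sym D≡G) (integral (rootLike G) i))))
        }
        where
        open ≡-Reasoning
        m = lookup μ
        g = lookup γ
        eq : ∀ D → + 2 * D + (+ 2 * D + + 2 * D + + 2 * 0ℤ) - + 2 * (D + D) ≡ + 2 * D
        eq = solve-∀
        dist : ∀ k x y z → k * x - (k * y + k * z) ≡ k * (x - (y + z))
        dist = solve-∀

      -- Four elements of Δ(1).

      module _ {γ₁ γ₂ γ₃ γ₄ : Vec ℤ n}
        (G₁ : Δ1Root γ₁) (G₂ : Δ1Root γ₂) (G₃ : Δ1Root γ₃) (G₄ : Δ1Root γ₄)
        where
        private
          g₁ = lookup γ₁
          g₂ = lookup γ₂
          g₃ = lookup γ₃
          g₄ = lookup γ₄
          total = g₁ ⊕ g₂ ⊕ (g₃ ⊕ g₄)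
          -- For an antichain all ten numbers are nonnegative, by `scale≤` and `incomparable⇒≤0`. A
          -- list allows their vanishing to be read off from that of the sum.
          deficits : List ℤ
          deficits = D - scale G₁ ∷ D - scale G₂ ∷ D - scale G₃ ∷ D - scale G₄ ∷
            - B g₁ g₂ ∷ - B g₁ g₃ ∷ - B g₁ g₄ ∷ - B g₂ g₃ ∷ - B g₂ g₄ ∷ - B g₃ g₄ ∷ []

        -- Both |2θ|² and (total , 2θ) equal 8D, so the norm is |total|² - 8D. The 8D is spread over
        -- the four scales as 2D each.
        four-norm : B (total ⊖ (t ⊕ t)) (total ⊖ (t ⊕ t)) ≡
          - (+ 2 * foldr _+_ 0ℤ deficits)
        four-norm = begin
          B (total ⊖ (t ⊕ t)) (total ⊖ (t ⊕ t))
            ≡⟨ norm-⊖ total (t ⊕ t) ⟩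
          B total total + B (t ⊕ t) (t ⊕ t) - + 2 * B total (t ⊕ t)
            ≡⟨ cong₂ (λ x y → x - + 2 * y)
                 (cong₂ _+_ norm-total (trans (norm-⊕ t t) (cong (λ x → x + x + + 2 * x) (norm Rθ))))
                 (trans (B-⊕ʳ total t t) (cong₂ _+_ pairing-total pairing-total)) ⟩
          + 2 * s₁ + + 2 * s₂ + + 2 * b₁₂ + (+ 2 * s₃ + + 2 * s₄ + + 2 * b₃₄)
            + + 2 * (b₁₃ + b₁₄ + (b₂₃ + b₂₄)) + (+ 2 * D + + 2 * D + + 2 * (+ 2 * D))
            - + 2 * (D + D + (D + D) + (D + D + (D + D)))
            ≡⟨ eq D s₁ s₂ s₃ s₄ b₁₂ b₁₃ b₁₄ b₂₃ b₂₄ b₃₄ ⟩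
          _ ∎
          where
          open ≡-Reasoning
          s₁ = scale G₁
          s₂ = scale G₂
          s₃ = scale G₃
          s₄ = scale G₄
          b₁₂ = B g₁ g₂
          b₁₃ = B g₁ g₃
          b₁₄ = B g₁ g₄
          b₂₃ = B g₂ g₃
          b₂₄ = B g₂ g₄
          b₃₄ = B g₃ g₄
          norm-pair : ∀ {μ γ} (M : Δ1Root μ) (G : Δ1Root γ) → let m = lookup μ; g = lookup γ in
            B (m ⊕ g) (m ⊕ g) ≡ + 2 * scale M + + 2 * scale G + + 2 * B m g
          norm-pair {μ} {γ} M G = trans (norm-⊕ (lookup μ) (lookup γ))
            (cong₂ (λ x y → x + y + + 2 * B (lookup μ) (lookup γ)) (norm (rootLike M)) (norm (rootLike G)))
          norm-total : B total total ≡
            + 2 * s₁ + + 2 * s₂ + + 2 * b₁₂ + (+ 2 * s₃ + + 2 * s₄ + + 2 * b₃₄)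
            + + 2 * (b₁₃ + b₁₄ + (b₂₃ + b₂₄))
          norm-total = trans (norm-⊕ (g₁ ⊕ g₂) (g₃ ⊕ g₄))
            (cong₂ (λ x y → x + + 2 * y) (cong₂ _+_ (norm-pair G₁ G₂) (norm-pair G₃ G₄))
              (trans (B-⊕ˡ g₁ g₂ (g₃ ⊕ g₄)) (cong₂ _+_ (B-⊕ʳ g₁ g₃ g₄) (B-⊕ʳ g₂ g₃ g₄))))
          pairing-total : B total t ≡ D + D + (D + D)
          pairing-total = trans (B-⊕ˡ (g₁ ⊕ g₂) (g₃ ⊕ g₄) t) (cong₂ _+_
            (trans (B-⊕ˡ g₁ g₂ t) (cong₂ _+_ (pairing G₁) (pairing G₂)))
            (trans (B-⊕ˡ g₃ g₄ t) (cong₂ _+_ (pairing G₃) (pairing G₄))))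
          eq : ∀ D a b c e p q r u v w →
            + 2 * a + + 2 * b + + 2 * p + (+ 2 * c + + 2 * e + + 2 * w)
            + + 2 * (q + r + (u + v)) + (+ 2 * D + + 2 * D + + 2 * (+ 2 * D))
            - + 2 * (D + D + (D + D) + (D + D + (D + D))) ≡
            - (+ 2 * ((D - a) + ((D - b) + ((D - c) + ((D - e) +
              (- p + (- q + (- r + (- u + (- v + (- w + 0ℤ)))))))))))
          eq = solve-∀

        four-antichain⇒⊥ : Incomparable γ₁ γ₂ → Incomparable γ₁ γ₃ → Incomparable γ₁ γ₄ →
          Incomparable γ₂ γ₃ → Incomparable γ₂ γ₄ → Incomparable γ₃ γ₄ → ⊥
        four-antichain⇒⊥ i₁₂ i₁₃ i₁₄ i₂₃ i₂₄ i₃₄ = conclude zero-deficits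
          where
          deficits-nonNeg : All (0ℤ ≤ℤ_) deficits
          deficits-nonNeg =
            ℤ.i≤j⇒0≤j-i (scale≤ G₁) ∷ ℤ.i≤j⇒0≤j-i (scale≤ G₂) ∷
            ℤ.i≤j⇒0≤j-i (scale≤ G₃) ∷ ℤ.i≤j⇒0≤j-i (scale≤ G₄) ∷
            neg-nonNeg (incomparable⇒≤0 G₁ G₂ i₁₂) ∷ neg-nonNeg (incomparable⇒≤0 G₁ G₃ i₁₃) ∷
            neg-nonNeg (incomparable⇒≤0 G₁ G₄ i₁₄) ∷ neg-nonNeg (incomparable⇒≤0 G₂ G₃ i₂₃) ∷
            neg-nonNeg (incomparable⇒≤0 G₂ G₄ i₂₄) ∷ neg-nonNeg (incomparable⇒≤0 G₃ G₄ i₃₄) ∷ []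

          Σdeficits = foldr _+_ 0ℤ deficits
          s = total ⊖ (t ⊕ t)

          norm≤0 : B s s ≤ℤ 0ℤ
          norm≤0 = subst (_≤ℤ 0ℤ) (sym four-norm)
            (ℤ.neg-mono-≤ (*-nonNeg {+ 2} {Σdeficits} (+≤+ z≤n) (foldr-+-nonNeg deficits-nonNeg)))

          -- The norm of `s` is nonnegative by positivity of the form and at most 0 by `four-norm`.
          Σdeficits≡0 : Σdeficits ≡ 0ℤ
          Σdeficits≡0 = ℤ.*-cancelˡ-≡ (+ 2) Σdeficits 0ℤ (ℤ.neg-injective
            (trans (sym four-norm) (ℤ.≤-antisym norm≤0 (norm-nonNeg s))))

          zero-deficits : All (_≡ 0ℤ) deficits
          zero-deficits = foldr-+-zero deficits-nonNeg Σdeficits≡0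

          neg≡0 : ∀ {x} → - x ≡ 0ℤ → x ≡ 0ℤ
          neg≡0 = ℤ.neg-injective

          β₁₂ = t ⊖ (g₁ ⊕ g₂)
          β₁₃ = t ⊖ (g₁ ⊕ g₃)

          contra : ∀ {μ γ f} → Δ1Root μ → Δ1Root γ → Incomparable μ γ → ConstantSign f →
            (∀ i → f i ≡ lookup γ i - lookup μ i) → ⊥
          contra M G (¬p , ¬q) c e = [ ¬p , ¬q ]′ (constantSign⇒comparable-Δ1 M G c e)

          -- Since `s` vanishes, 2θ is the sum of the four roots, and 2θ - 2γ₁ - γ₂ - γ₃ becomes γ₄
          -- - γ₁.
          β₁₂+β₁₃ : ∀ i → (β₁₂ ⊕ β₁₃) i ≡ g₄ i - g₁ i
          β₁₂+β₁₃ i = trans (eq (t i) (g₁ i) (g₂ i) (g₃ i) (g₄ i))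
            (trans (cong (_-_ (g₄ i - g₁ i)) (norm-≤0 s norm≤0 i)) (ℤ.+-identityʳ (g₄ i - g₁ i)))
            where
            eq : ∀ t a b c e → t - (a + b) + (t - (a + c)) ≡ e - a - (a + b + (c + e) - (t + t))
            eq = solve-∀

          β₁₂-β₁₃ : ∀ i → (β₁₂ ⊖ β₁₃) i ≡ g₃ i - g₂ i
          β₁₂-β₁₃ i = eq (t i) (g₁ i) (g₂ i) (g₃ i)
            where
            eq : ∀ t a b c → t - (a + b) - (t - (a + c)) ≡ c - b
            eq = solve-∀

          -- Equal signs give the sum a constant sign, making γ₁ and γ₄ comparable; opposite signs
          -- do so for the difference, with γ₂ and γ₃.
          clash : ConstantSign β₁₂ → ConstantSign β₁₃ → ⊥
          clash (inj₁ p) (inj₁ q) = contra G₁ G₄ i₁₄ (inj₁ λ i → ℤ.+-mono-≤ (p i) (q i)) β₁₂+β₁₃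
          clash (inj₂ p) (inj₂ q) = contra G₁ G₄ i₁₄ (inj₂ λ i → ℤ.+-mono-≤ (p i) (q i)) β₁₂+β₁₃
          clash (inj₁ p) (inj₂ q) = contra G₂ G₃ i₂₃
            (inj₁ λ i → ℤ.+-mono-≤ (p i) (neg-nonNeg (q i))) β₁₂-β₁₃
          clash (inj₂ p) (inj₁ q) = contra G₂ G₃ i₂₃
            (inj₂ λ i → ℤ.+-mono-≤ (p i) (ℤ.neg-mono-≤ (q i))) β₁₂-β₁₃

          conclude : All (_≡ 0ℤ) deficits → ⊥
          -- The vanishing deficits make γ₁, γ₂, γ₃ as long as θ, and γ₁ orthogonal to γ₂ and γ₃.
          conclude (e₁ ∷ e₂ ∷ e₃ ∷ _ ∷ b₁₂ ∷ b₁₃ ∷ _) = clash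
            (rootLike⇒constantSign (θ⊖⊕-rootLike G₁ G₂ (long e₁) (long e₂) (neg≡0 b₁₂)))
            (rootLike⇒constantSign (θ⊖⊕-rootLike G₁ G₃ (long e₁) (long e₃) (neg≡0 b₁₃)))
            where
            long : ∀ {x} → D - x ≡ 0ℤ → D ≡ x
            long {x} = ℤ.i-j≡0⇒i≡j D x

theorem4p8 : (n : ℕ) (A : Matrix n) (d : Fin n → ℕ) (θ : Vec ℤ n) →
    IsSimpleCartan n A d → IsHighestRoot A θ →
    (Γ : List (Vec ℤ n)) → IsAntichainΔ1 A d θ Γ → length Γ ≤ 3
theorem4p8 n A d θ C H [] _ = z≤n
theorem4p8 n A d θ C H (_ ∷ []) _ = s≤s z≤n
theorem4p8 n A d θ C H (_ ∷ _ ∷ []) _ = s≤s (s≤s z≤n)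
theorem4p8 n A d θ C H (_ ∷ _ ∷ _ ∷ []) _ = s≤s (s≤s (s≤s z≤n))
-- The first four entries of a longer list already give the contradiction.
theorem4p8 n A d θ C H (_ ∷ _ ∷ _ ∷ _ ∷ _)
  ( (m₁ ∷ m₂ ∷ m₃ ∷ m₄ ∷ _)
  , (i₁₂ ∷ i₁₃ ∷ i₁₄ ∷ _) ∷ (i₂₃ ∷ i₂₄ ∷ _) ∷ (i₃₄ ∷ _) ∷ _) =
  ⊥-elim (four-antichain⇒⊥ A d C H R
    (toΔ1 m₁) (toΔ1 m₂) (toΔ1 m₃) (toΔ1 m₄) i₁₂ i₁₃ i₁₄ i₂₃ i₂₄ i₃₄)
  where
  R = proj₂ (root⇒rootLike A d C (proj₁ H))
  toΔ1 : ∀ {γ} → InΔ1 A d θ γ → Δ1Root A d C H R γ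
  toΔ1 = InΔ1⇒Δ1Root A d C H R
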